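{- Let $\mathcal{M}=(S,E,T)$ be a trivially parametric Markov chain satisfying the standing assumptions below. Then every never-worse equivalence class that contains neither $\mathit{fin}$ nor $\mathit{fail}$ has exactly one exit.
   Context: A trivially parametric Markov chain $\mathcal{M}=(S,E,T)$ consists of a finite set of states $S$, targets $T=\{\mathit{fin},\mathit{fail}\}$ with no outgoing edges, and edges $E\subseteq(S\setminus T)\times S$. A graph-preserving valuation assigns to each non-target $s$ a full-support probability distribution on its successor set $sE$; $P_{\mathsf{val}}(s)$ is the probability of reaching $\mathit{fin}$ from $s$. $s\sim s'$ iff $P_{\mathsf{val}}(s)=P_{\mathsf{val}}(s')$ for all graph-preserving valuations; equivalence classes are the classes of $\sim$. A state $s$ is an exit of $U\subseteq S$ if $s\in U$ and $sE\not\subseteq U$. Standing assumptions: the equivalence classes of $\mathit{fin}$ and $\mathit{fail}$ are $\{\mathit{fin}\}$ and $\{\mathit{fail}\}$; no state has a self-loop; every non-target state has exactly two successors. -}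

module Defs where

open import Level using (_⊔_; suc)
open import Algebra.Apartness.Bundles using (HeytingField; HeytingCommutativeRing)
open import Algebra.Bundles using (CommutativeRing)
import Algebra.Definitions.RawMonoid as RawMonoidDefinitions
import Algebra.Properties.CommutativeMonoid.Sum as CommutativeMonoidSum
open import Data.Bool.Base using (if_then_else_)
open import Data.Fin.Base using (Fin)
open import Data.Fin.Properties using (_≟_)
open import Data.Fin.Subset using (Subset; _∈_; _∉_; _⊆_; Empty; ⁅_⁆; ∣_∣)
open import Data.Nat.Base as ℕ using (ℕ)
open import Data.Product.Base using (∃; _×_)
open import Data.Sum.Base using (_⊎_)
open import Function.Bundles using (_⇔_)
open import Relation.Binary.Core using (Rel)
open import Relation.Binary.PropositionalEquality.Core using (_≡_; _≢_)
open import Relation.Binary.Structures using (IsStrictPartialOrder)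
open import Relation.Nullary.Decidable.Core using (does)
open import Relation.Nullary.Negation.Core using (¬_)

-- The real numbers, given axiomatically as a Cauchy-complete Archimedean
-- ordered field.  Classically this determines ℝ up to unique isomorphism; the
-- axioms are phrased with apartness and a non-decidable order so that they
-- also hold constructively (e.g. for Cauchy sequences of rationals with
-- modulus).  A `HeytingField` may be the zero ring, hence `0<1`.
record Reals c ℓ₁ ℓ₂ ℓ₃ : Set (suc (c ⊔ ℓ₁ ⊔ ℓ₂ ⊔ ℓ₃)) where
  infix 4 _<_ _⟶_
  field
    heytingField : HeytingField c ℓ₁ ℓ₂

  open HeytingField heytingField public

  commutativeRing : CommutativeRing c ℓ₁
  commutativeRing = HeytingCommutativeRing.commutativeRing heytingCommutativeRing

  open CommutativeMonoidSum (CommutativeRing.+-commutativeMonoid commutativeRing)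
    public using (sum)
  open RawMonoidDefinitions (CommutativeRing.+-rawMonoid commutativeRing)
    public using () renaming (_×_ to _·_)

  field
    _<_                  : Rel Carrier ℓ₃
    isStrictPartialOrder : IsStrictPartialOrder _≈_ _<_
    #⇔<⊎>                : ∀ x y → (x # y) ⇔ (x < y ⊎ y < x)
    0<1                  : 0# < 1#
    +-monoˡ-<            : ∀ {x y} z → x < y → x + z < y + z
    *-pos                : ∀ {x y} → 0# < x → 0# < y → 0# < x * y
    archimedean          : ∀ x → ∃ λ n → x < n · 1#

  IsCauchy : (ℕ → Carrier) → Set (c ⊔ ℓ₃)
  IsCauchy f = ∀ ε → 0# < ε → ∃ λ N → ∀ i j → N ℕ.≤ i → N ℕ.≤ j →
    f i - f j < ε

  _⟶_ : (ℕ → Carrier) → Carrier → Set (c ⊔ ℓ₃)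
  f ⟶ l = ∀ ε → 0# < ε → ∃ λ N → ∀ i → N ℕ.≤ i →
    (f i - l < ε) × (l - f i < ε)

  field
    complete : ∀ f → IsCauchy f → ∃ λ l → f ⟶ l

-- The state set is `Fin n`, and `E s` is the successor set sE.
record TriviallyParametricMC (n : ℕ) : Set where
  field
    E         : Fin n → Subset n
    fin fail  : Fin n
    fin≢fail  : fin ≢ fail
    fin-sink  : Empty (E fin)
    fail-sink : Empty (E fail)

  NonTarget : Fin n → Set
  NonTarget s = s ≢ fin × s ≢ fail

  IsExit : Subset n → Fin n → Set
  IsExit U s = s ∈ U × ¬ (E s ⊆ U)

module Semantics {c ℓ₁ ℓ₂ ℓ₃} (ℝ : Reals c ℓ₁ ℓ₂ ℓ₃)
                 {n : ℕ} (M : TriviallyParametricMC n) where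

  infix 4 P[_,_]≔_ _∼_ _IsClassOf_

  open Reals ℝ
  open TriviallyParametricMC M

  -- `val s t` is the probability of moving from s to t; the rows of the two
  -- targets are never used.
  Valuation : Set c
  Valuation = Fin n → Fin n → Carrier

  record GraphPreserving (val : Valuation) : Set (c ⊔ ℓ₁ ⊔ ℓ₃) where
    field
      positive : ∀ {s t} → NonTarget s → t ∈ E s → 0# < val s t
      null     : ∀ {s t} → NonTarget s → t ∉ E s → val s t ≈ 0#
      total    : ∀ {s} → NonTarget s → sum (val s) ≈ 1#

  -- The probability of reaching fin from s within k steps.
  reach≤ : Valuation → ℕ → Fin n → Carrier
  reach≤ val ℕ.zero    s = if does (s ≟ fin) then 1# else 0#
  reach≤ val (ℕ.suc k) s =
    if does (s ≟ fin)  then 1# else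
    if does (s ≟ fail) then 0# else
    sum (λ t → val s t * reach≤ val k t)

  -- P_val(s) = p.  The events "fin is reached within k steps" increase to the
  -- event "fin is reached", so P_val(s) is the limit of their probabilities.
  P[_,_]≔_ : Valuation → Fin n → Carrier → Set (c ⊔ ℓ₃)
  P[ val , s ]≔ p = (λ k → reach≤ val k s) ⟶ p

  -- Never-worse equivalence: P_val(s) and P_val(t) are the same real number.
  _∼_ : Rel (Fin n) (c ⊔ ℓ₁ ⊔ ℓ₃)
  s ∼ t = ∀ val → GraphPreserving val →
    ∃ λ p → (P[ val , s ]≔ p) × (P[ val , t ]≔ p)

  _IsClassOf_ : Subset n → Fin n → Set (c ⊔ ℓ₁ ⊔ ℓ₃)
  U IsClassOf s = ∀ t → (t ∈ U) ⇔ (s ∼ t)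

  IsEquivalenceClass : Subset n → Set (c ⊔ ℓ₁ ⊔ ℓ₃)
  IsEquivalenceClass U = ∃ λ s → U IsClassOf s

  record StandingAssumptions : Set (c ⊔ ℓ₁ ⊔ ℓ₃) where
    field
      fin-class      : ⁅ fin ⁆ IsClassOf fin
      fail-class     : ⁅ fail ⁆ IsClassOf fail
      no-self-loops  : ∀ s → s ∉ E s
      two-successors : ∀ s → NonTarget s → ∣ E s ∣ ≡ 2

{-# OPTIONS --safe #-}
module Submission where

-- A path from a class U to a target leaves U at an exit.  Let z ≠ w be two
-- states of U.  Of two paths to a target one can be chosen, from w avoiding z
-- or from z avoiding w; say the former.  Change the distribution at z only, and
-- let D be the difference of the two value functions: it is harmonic off z,
-- vanishes on the targets and satisfies D w = D z.  By the maximum principle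
-- D = 0, so the values do not depend on the distribution at z.  Hence all
-- successors of z have the same value, that of z, and z is not an exit.
--
-- The reals have no decidable order, but the conclusion is decidable, so
-- reachability and maxima may be used under double negation; only the existence
-- of the values needs an explicit rate of convergence.

open import Defs
open import Data.Nat.Base using (ℕ)
open import Data.Fin.Subset using (Subset; _∉_)
open import Data.Product using (∃!)
open import Relation.Binary.PropositionalEquality using (_≡_)

open import Algebra.Bundles using (CommutativeRing)
import Algebra.Apartness.Properties.HeytingCommutativeRing as HeytingProperties
import Algebra.Properties.CommutativeSemigroup as CommutativeSemigroupProperties
import Algebra.Properties.Ring as RingProperties
import Algebra.Properties.Semiring.Sum as SemiringSum
open import Data.Bool.Base using (if_then_else_)
open import Data.Fin.Base using (Fin; zero; suc)
open import Data.Fin.Properties using (_≟_; any?; sequence)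
open import Data.Fin.Subset using (_∈_; _⊆_)
open import Data.Fin.Subset.Properties using (_∈?_; _⊆?_; x∈⁅y⁆⇒x≡y)
import Data.Nat.Base as ℕ
import Data.Nat.Properties as ℕ
open import Data.Product.Base using (∃; _×_; _,_; proj₁; proj₂)
open import Data.Sum.Base using (_⊎_; inj₁; inj₂; [_,_]′)
open import Data.Unit.Base using (⊤; tt)
open import Effect.Monad using (RawMonad)
open import Function.Base using (_∘_; _$_)
open import Function.Bundles using (Equivalence)
open import Level using (Level)
open import Relation.Binary.Core using (Rel)
open import Relation.Binary.PropositionalEquality as ≡ using (_≢_)
import Relation.Binary.Reasoning.Base.Triple as TripleReasoning
open import Relation.Binary.Structures using (IsPreorder; IsStrictPartialOrder)
open import Relation.Nullary.Decidable
  using (Dec; yes; no; does; ¬¬-excluded-middle; dec-true; dec-false; decidable-stable; _×-dec_; ¬?)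
open import Relation.Nullary.Negation using (¬_; contradiction; ¬¬-Monad)

-- Ordered-field arithmetic without a decidable order.

module RealProperties {c ℓ₁ ℓ₂ ℓ₃ : Level} (ℝ : Reals c ℓ₁ ℓ₂ ℓ₃) where

  open Reals ℝ hiding (zero)
  open CommutativeRing commutativeRing using (ring)
  open IsStrictPartialOrder isStrictPartialOrder using (<-resp-≈; asym)
    renaming (irrefl to <-irrefl; trans to <-trans)
  open RingProperties ring using (x[y-z]≈xy-xz)
  open HeytingProperties heytingCommutativeRing using (invertibleˡ⇒#; x-0≈x)

  infix 4 _≤_

  -- As the negation of the strict order, the weak order is stable under double negation, so an
  -- inequality may be derived from facts known only under double negation.
  _≤_ : Rel Carrier ℓ₃
  x ≤ y = ¬ (y < x)

  <⇒# : ∀ {x y} → x < y → x # y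
  <⇒# {x} {y} x<y = Equivalence.from (#⇔<⊎> x y) (inj₁ x<y)

  #⇒<⊎> : ∀ {x y} → x # y → x < y ⊎ y < x
  #⇒<⊎> {x} {y} = Equivalence.to (#⇔<⊎> x y)

  <⇒≤ : ∀ {x y} → x < y → x ≤ y
  <⇒≤ = asym

  -- Cotransitivity of apartness replaces trichotomy: once `z` is apart from `x` or from `y`, its
  -- side is known, and in the unhelpful orientations transitivity with `x < y` gives the other
  -- alternative.
  <-cotrans : ∀ {x y} → x < y → ∀ z → x < z ⊎ z < y
  <-cotrans x<y z with #-cotrans (<⇒# x<y) z
  ... | inj₁ x#z with #⇒<⊎> x#z
  ...   | inj₁ x<z = inj₁ x<z
  ...   | inj₂ z<x = inj₂ (<-trans z<x x<y)
  <-cotrans x<y z | inj₂ z#y with #⇒<⊎> z#y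
  ...   | inj₁ z<y = inj₂ z<y
  ...   | inj₂ y<z = inj₁ (<-trans x<y y<z)

  ≤-<-trans : ∀ {x y z} → x ≤ y → y < z → x < z
  ≤-<-trans {x} x≤y y<z with <-cotrans y<z x
  ... | inj₁ y<x = contradiction y<x x≤y
  ... | inj₂ x<z = x<z

  <-≤-trans : ∀ {x y z} → x < y → y ≤ z → x < z
  <-≤-trans {z = z} x<y y≤z with <-cotrans x<y z
  ... | inj₁ x<z = x<z
  ... | inj₂ z<y = contradiction z<y y≤z

  -- Tightness of apartness turns the refutation of both strict orders into equality.
  ≤-antisym : ∀ {x y} → x ≤ y → y ≤ x → x ≈ y
  ≤-antisym {x} {y} x≤y y≤x = proj₁ (tight x y) λ x#y → case-# (#⇒<⊎> x#y)
    where
    case-# : ¬ (x < y ⊎ y < x)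
    case-# (inj₁ x<y) = y≤x x<y
    case-# (inj₂ y<x) = x≤y y<x

  ≤-isPreorder : IsPreorder _≈_ _≤_
  ≤-isPreorder = record
    { isEquivalence = isEquivalence
    ; reflexive     = λ x≈y → <-irrefl (sym x≈y)
    ; trans         = λ x≤y y≤z z<x → y≤z (<-≤-trans z<x x≤y)
    }

  open IsPreorder ≤-isPreorder public
    using () renaming (refl to ≤-refl; reflexive to ≤-reflexive; trans to ≤-trans)

  module ≤-Reasoning = TripleReasoning ≤-isPreorder asym <-trans <-resp-≈ asym <-≤-trans ≤-<-trans
  open ≤-Reasoning

  x+y-y≈x : ∀ x y → x + y - y ≈ x
  x+y-y≈x x y = trans (+-assoc x y (- y)) (trans (+-congˡ (-‿inverseʳ y)) (+-identityʳ x))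

  x-y+y≈x : ∀ x y → x - y + y ≈ x
  x-y+y≈x x y = trans (+-assoc x (- y) y) (trans (+-congˡ (-‿inverseˡ y)) (+-identityʳ x))

  +-monoʳ-< : ∀ {x y} z → x < y → z + x < z + y
  +-monoʳ-< {x} {y} z x<y = begin-strict
    z + x ≈⟨ +-comm z x ⟩
    x + z <⟨ +-monoˡ-< z x<y ⟩
    y + z ≈⟨ +-comm y z ⟩
    z + y ∎

  +-cancelʳ-< : ∀ {x y} z → x + z < y + z → x < y
  +-cancelʳ-< {x} {y} z x+z<y+z = begin-strict
    x         ≈⟨ x+y-y≈x x z ⟨
    x + z - z <⟨ +-monoˡ-< (- z) x+z<y+z ⟩
    y + z - z ≈⟨ x+y-y≈x y z ⟩
    y         ∎

  +-cancelˡ-< : ∀ {x y} z → z + x < z + y → x < y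
  +-cancelˡ-< {x} {y} z z+x<z+y = +-cancelʳ-< z (begin-strict
    x + z ≈⟨ +-comm x z ⟩
    z + x <⟨ z+x<z+y ⟩
    z + y ≈⟨ +-comm z y ⟩
    y + z ∎)

  +-monoˡ-≤ : ∀ {x y} z → x ≤ y → x + z ≤ y + z
  +-monoˡ-≤ z x≤y = x≤y ∘ +-cancelʳ-< z

  +-monoʳ-≤ : ∀ {x y} z → x ≤ y → z + x ≤ z + y
  +-monoʳ-≤ z x≤y = x≤y ∘ +-cancelˡ-< z

  +-mono-≤ : ∀ {x y u v} → x ≤ y → u ≤ v → x + u ≤ y + v
  +-mono-≤ {y = y} {u} x≤y u≤v = ≤-trans (+-monoˡ-≤ u x≤y) (+-monoʳ-≤ y u≤v)

  x<y⇒0<y-x : ∀ {x y} → x < y → 0# < y - x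
  x<y⇒0<y-x {x} {y} x<y = begin-strict
    0#    ≈⟨ -‿inverseʳ x ⟨
    x - x <⟨ +-monoˡ-< (- x) x<y ⟩
    y - x ∎

  *-monoʳ-< : ∀ {a x y} → 0# < a → x < y → a * x < a * y
  *-monoʳ-< {a} {x} {y} 0<a x<y = begin-strict
    a * x               ≈⟨ +-identityˡ (a * x) ⟨
    0# + a * x          <⟨ +-monoˡ-< (a * x) (*-pos 0<a (x<y⇒0<y-x x<y)) ⟩
    a * (y - x) + a * x ≈⟨ distribˡ a (y - x) x ⟨
    a * (y - x + x)     ≈⟨ *-congˡ (x-y+y≈x y x) ⟩
    a * y               ∎

  -- The difference of the two products factors as `a * (x - y)` and is invertible; a factor of an
  -- invertible element is invertible, hence apart from zero.
  *-cancelˡ-# : ∀ a {x y} → a * x # a * y → a # 0# × x # y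
  *-cancelˡ-# a {x} {y} ax#ay with #⇒invertible ax#ay
  ... | i , i*[ax-ay]≈1 , _ =
      invertibleˡ⇒# (i * (x - y) , (begin-equality
        i * (x - y) * (a - 0#)  ≈⟨ *-congˡ (x-0≈x a) ⟩
        i * (x - y) * a         ≈⟨ *-assoc i (x - y) a ⟩
        i * ((x - y) * a)       ≈⟨ *-congˡ (*-comm (x - y) a) ⟩
        i * (a * (x - y))       ≈⟨ i*a[x-y]≈1 ⟩
        1#                      ∎))
    , invertibleˡ⇒# (i * a , trans (*-assoc i a (x - y)) i*a[x-y]≈1)
    where
    i*a[x-y]≈1 : i * (a * (x - y)) ≈ 1#
    i*a[x-y]≈1 = trans (*-congˡ (x[y-z]≈xy-xz a x y)) i*[ax-ay]≈1

  -- Strict positivity of `a` is recovered from the strict inequality itself, since products that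
  -- are apart force `a` apart from zero. This makes multiplication by a possibly zero weight
  -- monotone without deciding whether the weight vanishes.
  *-cancelˡ-< : ∀ {a x y} → 0# ≤ a → a * x < a * y → x < y
  *-cancelˡ-< {a} {x} {y} 0≤a ax<ay with *-cancelˡ-# a (<⇒# ax<ay)
  ... | a#0 , x#y with #⇒<⊎> a#0 | #⇒<⊎> x#y
  ...   | inj₁ a<0 | _        = contradiction a<0 0≤a
  ...   | inj₂ 0<a | inj₁ x<y = x<y
  ...   | inj₂ 0<a | inj₂ y<x = contradiction (*-monoʳ-< 0<a y<x) (asym ax<ay)

  *-monoʳ-≤ : ∀ {a x y} → 0# ≤ a → x ≤ y → a * x ≤ a * y
  *-monoʳ-≤ 0≤a x≤y = x≤y ∘ *-cancelˡ-< 0≤a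

  *-cancelˡ-≈ : ∀ {a x y} → 0# < a → a * x ≈ a * y → x ≈ y
  *-cancelˡ-≈ 0<a ax≈ay = ≤-antisym
    (λ y<x → <-irrefl (sym ax≈ay) (*-monoʳ-< 0<a y<x))
    (λ x<y → <-irrefl ax≈ay (*-monoʳ-< 0<a x<y))

  0≤1 : 0# ≤ 1#
  0≤1 = asym 0<1

  0<2 : 0# < 1# + 1#
  0<2 = begin-strict
    0#      <⟨ 0<1 ⟩
    1#      ≈⟨ +-identityʳ 1# ⟨
    1# + 0# <⟨ +-monoʳ-< 1# 0<1 ⟩
    1# + 1# ∎

  abstract
    positive⇒inverse : ∀ {x} → 0# < x → ∃ λ y → x * y ≈ 1#
    positive⇒inverse {x} 0<x with #⇒invertible (#-sym (<⇒# 0<x))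
    ... | y , _ , [x-0]y≈1 = y , trans (*-congʳ (sym (x-0≈x x))) [x-0]y≈1

  abstract
    2⁻¹ : ∃ λ h → (1# + 1#) * h ≈ 1#
    2⁻¹ = positive⇒inverse 0<2

  ½ : Carrier
  ½ = proj₁ 2⁻¹

  0<½ : 0# < ½
  0<½ = *-cancelˡ-< (asym 0<2) $ begin-strict
    (1# + 1#) * 0# ≈⟨ zeroʳ (1# + 1#) ⟩
    0#             <⟨ 0<1 ⟩
    1#             ≈⟨ proj₂ 2⁻¹ ⟨
    (1# + 1#) * ½  ∎

  ½x+½x≈x : ∀ x → ½ * x + ½ * x ≈ x
  ½x+½x≈x x = begin-equality
    ½ * x + ½ * x             ≈⟨ distribʳ x ½ ½ ⟨
    (½ + ½) * x               ≈⟨ *-congʳ (+-cong (*-identityˡ ½) (*-identityˡ ½)) ⟨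
    (1# * ½ + 1# * ½) * x     ≈⟨ *-congʳ (distribʳ ½ 1# 1#) ⟨
    (1# + 1#) * ½ * x         ≈⟨ *-congʳ (proj₂ 2⁻¹) ⟩
    1# * x                    ≈⟨ *-identityˡ x ⟩
    x                         ∎

  x<y+z⇒x-y<z : ∀ {x y z} → x < y + z → x - y < z
  x<y+z⇒x-y<z {x} {y} {z} x<y+z = +-cancelʳ-< y $ begin-strict
    x - y + y ≈⟨ x-y+y≈x x y ⟩
    x         <⟨ x<y+z ⟩
    y + z     ≈⟨ +-comm y z ⟩
    z + y     ∎

  x-y<z⇒x<y+z : ∀ {x y z} → x - y < z → x < y + z
  x-y<z⇒x<y+z {x} {y} {z} x-y<z = begin-strict
    x         ≈⟨ x-y+y≈x x y ⟨
    x - y + y <⟨ +-monoˡ-< y x-y<z ⟩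
    z + y     ≈⟨ +-comm z y ⟩
    y + z     ∎

  -- Limit arguments lose `ε` twice, once at each of two approximations. With `ε` half of a supposed
  -- gap `x - y`, the hypothesis becomes `x < x`.
  <+ε+ε⇒≤ : ∀ {x y} → (∀ ε → 0# < ε → x < (y + ε) + ε) → x ≤ y
  <+ε+ε⇒≤ {x} {y} x<y+2ε y<x = <-irrefl refl $ begin-strict
    x               <⟨ x<y+2ε ε (*-pos 0<½ (x<y⇒0<y-x y<x)) ⟩
    (y + ε) + ε     ≈⟨ +-assoc y ε ε ⟩
    y + (ε + ε)     ≈⟨ +-congˡ (½x+½x≈x (x - y)) ⟩
    y + (x - y)     ≈⟨ +-comm y (x - y) ⟩
    x - y + y       ≈⟨ x-y+y≈x x y ⟩
    x               ∎
    where
    ε : Carrier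
    ε = ½ * (x - y)

  -- Limits of sequences.

  ⟶-const : ∀ {f l} → (∀ k → f k ≈ l) → f ⟶ l
  ⟶-const {f} {l} f≈l ε 0<ε = 0 , λ i _ →
      (begin-strict f i - l ≈⟨ +-congʳ (f≈l i) ⟩ l - l ≈⟨ -‿inverseʳ l ⟩ 0# <⟨ 0<ε ⟩ ε ∎)
    , (begin-strict l - f i ≈⟨ +-congˡ (-‿cong (f≈l i)) ⟩ l - l ≈⟨ -‿inverseʳ l ⟩ 0# <⟨ 0<ε ⟩ ε ∎)

  ⟶-respʳ-≈ : ∀ {f x y} → x ≈ y → f ⟶ x → f ⟶ y
  ⟶-respʳ-≈ x≈y f⟶x ε 0<ε with f⟶x ε 0<ε
  ... | N , close = N , λ i N≤i →
      (begin-strict _ ≈⟨ +-congˡ (-‿cong x≈y) ⟨ _ <⟨ proj₁ (close i N≤i) ⟩ ε ∎)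
    , (begin-strict _ ≈⟨ +-congʳ x≈y ⟨ _ <⟨ proj₂ (close i N≤i) ⟩ ε ∎)

  ⟶-unique : ∀ {f p q} → f ⟶ p → f ⟶ q → p ≈ q
  ⟶-unique f⟶p f⟶q = ≤-antisym (⟶-≤ f⟶p f⟶q) (⟶-≤ f⟶q f⟶p)
    where
    ⟶-≤ : ∀ {f p q} → f ⟶ p → f ⟶ q → p ≤ q
    ⟶-≤ {f} {p} {q} f⟶p f⟶q = <+ε+ε⇒≤ λ ε 0<ε →
      let (K , near-p) = f⟶p ε 0<ε
          (L , near-q) = f⟶q ε 0<ε
          i = K ℕ.⊔ L
      in begin-strict
        p           <⟨ x-y<z⇒x<y+z (proj₂ (near-p i (ℕ.m≤m⊔n K L))) ⟩
        f i + ε     <⟨ +-monoˡ-< ε (x-y<z⇒x<y+z (proj₁ (near-q i (ℕ.m≤n⊔m K L)))) ⟩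
        q + ε + ε   ∎

  -- Finite sums, positive lower bounds and maxima.

  sum-mono-≤ : ∀ {n} {f g : Fin n → Carrier} → (∀ i → f i ≤ g i) → sum f ≤ sum g
  sum-mono-≤ {ℕ.zero}  f≤g = ≤-refl
  sum-mono-≤ {ℕ.suc n} f≤g = +-mono-≤ (f≤g zero) (sum-mono-≤ (f≤g ∘ suc))

  sum-mono-< : ∀ {n} {f g : Fin n → Carrier} i → (∀ j → f j ≤ g j) → f i < g i → sum f < sum g
  sum-mono-< {f = f} {g} zero f≤g fi<gi = begin-strict
    f zero + sum (f ∘ suc) <⟨ +-monoˡ-< _ fi<gi ⟩
    g zero + sum (f ∘ suc) ≤⟨ +-monoʳ-≤ _ (sum-mono-≤ (f≤g ∘ suc)) ⟩
    g zero + sum (g ∘ suc) ∎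
  sum-mono-< {f = f} {g} (suc i) f≤g fi<gi = begin-strict
    f zero + sum (f ∘ suc) <⟨ +-monoʳ-< _ (sum-mono-< i (f≤g ∘ suc) fi<gi) ⟩
    f zero + sum (g ∘ suc) ≤⟨ +-monoˡ-≤ _ (f≤g zero) ⟩
    g zero + sum (g ∘ suc) ∎

  ½x<x : ∀ {x} → 0# < x → ½ * x < x
  ½x<x {x} 0<x = begin-strict
    ½ * x         ≈⟨ +-identityʳ (½ * x) ⟨
    ½ * x + 0#    <⟨ +-monoʳ-< (½ * x) (*-pos 0<½ 0<x) ⟩
    ½ * x + ½ * x ≈⟨ ½x+½x≈x x ⟩
    x             ∎

  -- A minimum cannot be selected by deciding the order. Comparing `y` with the strict inequality
  -- `½ * x < x` suffices: in one case `½ * x` is below both, in the other `y` is.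
  binary-lower-bound : ∀ {x y} → 0# < x → 0# < y → ∃ λ δ → 0# < δ × δ ≤ x × δ ≤ y
  binary-lower-bound {x} {y} 0<x 0<y with <-cotrans (½x<x 0<x) y
  ... | inj₁ ½x<y = ½ * x , *-pos 0<½ 0<x , asym (½x<x 0<x) , asym ½x<y
  ... | inj₂ y<x  = y , 0<y , asym y<x , ≤-refl

  positive-lower-bound : ∀ {n} (f : Fin n → Carrier) → (∀ i → 0# < f i) →
    ∃ λ δ → 0# < δ × (∀ i → δ ≤ f i)
  positive-lower-bound {ℕ.zero}  f 0<f = 1# , 0<1 , λ ()
  positive-lower-bound {ℕ.suc n} f 0<f with positive-lower-bound (f ∘ suc) (0<f ∘ suc)
  ... | δ , 0<δ , δ≤f with binary-lower-bound (0<f zero) 0<δ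
  ...   | γ , 0<γ , γ≤f₀ , γ≤δ = γ , 0<γ , λ { zero → γ≤f₀ ; (suc i) → ≤-trans γ≤δ (δ≤f i) }

  -- Comparing the head with the maximum of the tail uses excluded middle, hence the double
  -- negation; the argument of type `Fin n` rules out the empty family.
  ¬¬-maximum : ∀ {n} (f : Fin n → Carrier) → Fin n → ¬ ¬ (∃ λ i → ∀ j → f j ≤ f i)
  ¬¬-maximum {ℕ.suc ℕ.zero}    f _ no-max = no-max (zero , λ { zero → ≤-refl })
  ¬¬-maximum {ℕ.suc (ℕ.suc n)} f _ no-max = ¬¬-maximum (f ∘ suc) zero λ (i , f≤fi) →
    ¬¬-excluded-middle λ where
      (yes fi<f₀) → no-max (zero , λ { zero → ≤-refl ; (suc j) → ≤-trans (f≤fi j) (asym fi<f₀) })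
      (no f₀≤fi)  → no-max (suc i , λ { zero → f₀≤fi ; (suc j) → f≤fi j })

-- Finite conjunctions of double-negated and of eventual statements.

¬¬-Π : ∀ {n} {p : Level} {P : Fin n → Set p} → (∀ i → ¬ ¬ P i) → ¬ ¬ (∀ i → P i)
¬¬-Π = sequence (RawMonad.rawApplicative ¬¬-Monad)

eventually-Π : ∀ {n} {p : Level} {P : Fin n → ℕ → Set p} →
  (∀ i → ∃ λ N → ∀ k → N ℕ.≤ k → P i k) → ∃ λ N → ∀ i k → N ℕ.≤ k → P i k
eventually-Π {ℕ.zero}  ev = 0 , λ ()
eventually-Π {ℕ.suc n} ev with ev zero | eventually-Π (ev ∘ suc)
... | M , P₀ | N , Pₛ = M ℕ.⊔ N , λ where
  zero    k M⊔N≤k → P₀ k (ℕ.≤-trans (ℕ.m≤m⊔n M N) M⊔N≤k)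
  (suc i) k M⊔N≤k → Pₛ i k (ℕ.≤-trans (ℕ.m≤n⊔m M N) M⊔N≤k)

-- Paths and one-step averages of a chain.

module ChainProperties {c ℓ₁ ℓ₂ ℓ₃ : Level} (ℝ : Reals c ℓ₁ ℓ₂ ℓ₃)
                       {n : ℕ} (M : TriviallyParametricMC n) where

  open Reals ℝ hiding (zero)
  open CommutativeRing commutativeRing using (ring; semiring; *-commutativeSemigroup)
  open SemiringSum semiring using (sum-cong-≋; ∑-distrib-+; *-distribˡ-sum; *-distribʳ-sum)
  open CommutativeSemigroupProperties *-commutativeSemigroup using (x∙yz≈y∙xz)
  open RingProperties ring using (-1*x≈-x; +-cancelˡ; +-cancelʳ)
  open RealProperties ℝ
  open ≤-Reasoning hiding (stop)
  open TriviallyParametricMC M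
  open Semantics ℝ M

  Target : Fin n → Set
  Target s = s ≡ fin ⊎ s ≡ fail

  classify : ∀ s → Target s ⊎ NonTarget s
  classify s with s ≟ fin | s ≟ fail
  ... | yes s≡fin | _          = inj₁ (inj₁ s≡fin)
  ... | no  _     | yes s≡fail = inj₁ (inj₂ s≡fail)
  ... | no  s≢fin | no  s≢fail = inj₂ (s≢fin , s≢fail)

  -- The final target of the path need not satisfy A.
  data PathToTarget (A : Fin n → Set) (s : Fin n) : Set where
    stop : Target s → PathToTarget A s
    step : ∀ {t} → A s → t ∈ E s → PathToTarget A t → PathToTarget A s

  -- A property of the graph alone. If all states have it, absorption with probability one follows
  -- for every graph-preserving valuation, as `escape-vanishes` shows.
  Absorbed : Fin n → Set
  Absorbed = PathToTarget (λ _ → ⊤)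

  successor⇒nonTarget : ∀ {s t} → t ∈ E s → NonTarget s
  successor⇒nonTarget t∈Es = (λ { ≡.refl → fin-sink (_ , t∈Es) }) , (λ { ≡.refl → fail-sink (_ , t∈Es) })

  average : Valuation → Fin n → (Fin n → Carrier) → Carrier
  average val s f = sum (λ t → val s t * f t)

  module _ (val : Valuation) (s : Fin n) where

    average-cong : ∀ {f g} → (∀ t → f t ≈ g t) → average val s f ≈ average val s g
    average-cong f≈g = sum-cong-≋ λ t → *-congˡ (f≈g t)

    average-+ : ∀ f g → average val s (λ t → f t + g t) ≈ average val s f + average val s g
    average-+ f g = trans (sum-cong-≋ λ t → distribˡ (val s t) (f t) (g t))
                          (∑-distrib-+ (λ t → val s t * f t) (λ t → val s t * g t))

    average-* : ∀ a f → average val s (λ t → a * f t) ≈ a * average val s f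
    average-* a f = trans (sum-cong-≋ λ t → x∙yz≈y∙xz (val s t) a (f t))
                          (sym (*-distribˡ-sum a (λ t → val s t * f t)))

    average-1 : average val s (λ _ → 1#) ≈ sum (val s)
    average-1 = sum-cong-≋ λ t → *-identityʳ (val s t)

    average-neg : ∀ f → average val s (-_ ∘ f) ≈ - average val s f
    average-neg f = begin-equality
      average val s (-_ ∘ f)             ≈⟨ average-cong (λ t → -1*x≈-x (f t)) ⟨
      average val s (λ t → - 1# * f t)   ≈⟨ average-* (- 1#) f ⟩
      - 1# * average val s f             ≈⟨ -1*x≈-x (average val s f) ⟩
      - average val s f                  ∎

  module _ {val : Valuation} (gp : GraphPreserving val) {s : Fin n} (nt : NonTarget s) where
    open GraphPreserving gp

    -- Weights outside the successor set are zero, so the functions may differ there arbitrarily.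
    average-cong-successors : ∀ {f g} → (∀ {t} → t ∈ E s → f t ≈ g t) → average val s f ≈ average val s g
    average-cong-successors {f} {g} f≈g = sum-cong-≋ term
      where
      term : ∀ t → val s t * f t ≈ val s t * g t
      term t with t ∈? E s
      ... | yes t∈Es = *-congˡ (f≈g t∈Es)
      ... | no  t∉Es = begin-equality
        val s t * f t ≈⟨ *-congʳ (null nt t∉Es) ⟩
        0# * f t      ≈⟨ zeroˡ (f t) ⟩
        0#            ≈⟨ zeroˡ (g t) ⟨
        0# * g t      ≈⟨ *-congʳ (null nt t∉Es) ⟨
        val s t * g t ∎

    weight-nonNegative : ∀ t → 0# ≤ val s t
    weight-nonNegative t with t ∈? E s
    ... | yes t∈Es = <⇒≤ (positive nt t∈Es)
    ... | no  t∉Es = ≤-reflexive (sym (null nt t∉Es))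

    average-mono-≤ : ∀ {f g} → (∀ t → f t ≤ g t) → average val s f ≤ average val s g
    average-mono-≤ f≤g = sum-mono-≤ λ t → *-monoʳ-≤ (weight-nonNegative t) (f≤g t)

    -- Strictness at a single successor suffices because its weight is positive. Both `escape<1` and
    -- the maximum principle rest on this.
    average-mono-< : ∀ {f g t} → t ∈ E s → (∀ u → f u ≤ g u) → f t < g t →
      average val s f < average val s g
    average-mono-< {t = t} t∈Es f≤g ft<gt =
      sum-mono-< t (λ u → *-monoʳ-≤ (weight-nonNegative u) (f≤g u))
                   (*-monoʳ-< (positive nt t∈Es) ft<gt)

    average-const : ∀ a → average val s (λ _ → a) ≈ a
    average-const a = begin-equality
      sum (λ t → val s t * a) ≈⟨ *-distribʳ-sum a (val s) ⟨
      sum (val s) * a         ≈⟨ *-congʳ (total nt) ⟩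
      1# * a                  ≈⟨ *-identityˡ a ⟩
      a                       ∎

    average-+const : ∀ f a → average val s (λ t → f t + a) ≈ average val s f + a
    average-+const f a = trans (average-+ val s f (λ _ → a)) (+-congˡ (average-const a))

  -- Step-bounded reachability probabilities.

  reach≤-fin : ∀ val k → reach≤ val k fin ≡ 1#
  reach≤-fin val ℕ.zero    rewrite dec-true (fin ≟ fin) ≡.refl = ≡.refl
  reach≤-fin val (ℕ.suc k) rewrite dec-true (fin ≟ fin) ≡.refl = ≡.refl

  reach≤-fail : ∀ val k → reach≤ val k fail ≡ 0#
  reach≤-fail val ℕ.zero    rewrite dec-false (fail ≟ fin) (≡.≢-sym fin≢fail) = ≡.refl
  reach≤-fail val (ℕ.suc k)
    rewrite dec-false (fail ≟ fin) (≡.≢-sym fin≢fail) | dec-true (fail ≟ fail) ≡.refl = ≡.refl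

  reach≤-zero : ∀ val {s} → NonTarget s → reach≤ val 0 s ≡ 0#
  reach≤-zero val {s} (s≢fin , _) rewrite dec-false (s ≟ fin) s≢fin = ≡.refl

  reach≤-suc : ∀ val k {s} → NonTarget s → reach≤ val (ℕ.suc k) s ≡ average val s (reach≤ val k)
  reach≤-suc val k {s} (s≢fin , s≢fail)
    rewrite dec-false (s ≟ fin) s≢fin | dec-false (s ≟ fail) s≢fail = ≡.refl

  reach≤-target : ∀ val j k {s} → Target s → reach≤ val j s ≡ reach≤ val k s
  reach≤-target val j k (inj₁ ≡.refl) = ≡.trans (reach≤-fin val j) (≡.sym (reach≤-fin val k))
  reach≤-target val j k (inj₂ ≡.refl) = ≡.trans (reach≤-fail val j) (≡.sym (reach≤-fail val k))

  module _ {val : Valuation} (gp : GraphPreserving val) where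

    reach≤-nonNegative : ∀ k s → 0# ≤ reach≤ val k s
    reach≤-nonNegative k s with classify s
    reach≤-nonNegative k _ | inj₁ (inj₁ ≡.refl) = ≡.subst (0# ≤_) (≡.sym (reach≤-fin val k)) 0≤1
    reach≤-nonNegative k _ | inj₁ (inj₂ ≡.refl) = ≡.subst (0# ≤_) (≡.sym (reach≤-fail val k)) ≤-refl
    reach≤-nonNegative ℕ.zero s | inj₂ nt = ≤-reflexive (reflexive (≡.sym (reach≤-zero val nt)))
    reach≤-nonNegative (ℕ.suc k) s | inj₂ nt = begin
      0#                          ≈⟨ average-const gp nt 0# ⟨
      average val s (λ _ → 0#)    ≤⟨ average-mono-≤ gp nt (reach≤-nonNegative k) ⟩
      average val s (reach≤ val k) ≡⟨ reach≤-suc val k nt ⟨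
      reach≤ val (ℕ.suc k) s      ∎

    reach≤-≤1 : ∀ k s → reach≤ val k s ≤ 1#
    reach≤-≤1 k s with classify s
    reach≤-≤1 k _ | inj₁ (inj₁ ≡.refl) = ≡.subst (_≤ 1#) (≡.sym (reach≤-fin val k)) ≤-refl
    reach≤-≤1 k _ | inj₁ (inj₂ ≡.refl) = ≡.subst (_≤ 1#) (≡.sym (reach≤-fail val k)) 0≤1
    reach≤-≤1 ℕ.zero s | inj₂ nt = ≡.subst (_≤ 1#) (≡.sym (reach≤-zero val nt)) 0≤1
    reach≤-≤1 (ℕ.suc k) s | inj₂ nt = begin
      reach≤ val (ℕ.suc k) s       ≡⟨ reach≤-suc val k nt ⟩
      average val s (reach≤ val k) ≤⟨ average-mono-≤ gp nt (reach≤-≤1 k) ⟩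
      average val s (λ _ → 1#)     ≈⟨ average-const gp nt 1# ⟩
      1#                           ∎

  -- The probability of not having reached a target within k steps, except
  -- that it starts at 1 also on the targets.
  escape : Valuation → ℕ → Fin n → Carrier
  escape val ℕ.zero    s = 1#
  escape val (ℕ.suc k) s = [ (λ _ → 0#) , (λ _ → average val s (escape val k)) ]′ (classify s)

  escape-target : ∀ val k {s} → Target s → escape val (ℕ.suc k) s ≡ 0#
  escape-target val k {s} s∈T with classify s
  ... | inj₁ _ = ≡.refl
  escape-target val k (inj₁ s≡fin)  | inj₂ (s≢fin , _)  = contradiction s≡fin s≢fin
  escape-target val k (inj₂ s≡fail) | inj₂ (_ , s≢fail) = contradiction s≡fail s≢fail

  escape-suc : ∀ val k {s} → NonTarget s → escape val (ℕ.suc k) s ≡ average val s (escape val k)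
  escape-suc val k {s} (s≢fin , s≢fail) with classify s
  ... | inj₁ (inj₁ s≡fin)  = contradiction s≡fin s≢fin
  ... | inj₁ (inj₂ s≡fail) = contradiction s≡fail s≢fail
  ... | inj₂ _             = ≡.refl

  ·1-nonNegative : ∀ m → 0# ≤ m · 1#
  ·1-nonNegative ℕ.zero    = ≤-refl
  ·1-nonNegative (ℕ.suc m) = begin
    0#          ≈⟨ +-identityʳ 0# ⟨
    0# + 0#     ≤⟨ +-mono-≤ 0≤1 (·1-nonNegative m) ⟩
    1# + m · 1# ∎

  -- Existence and harmonicity of the values.

  module Convergence {val : Valuation} (gp : GraphPreserving val) (absorbed : ∀ s → Absorbed s) where

    escape-nonNegative : ∀ k s → 0# ≤ escape val k s
    escape-nonNegative ℕ.zero s = 0≤1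
    escape-nonNegative (ℕ.suc k) s with classify s
    ... | inj₁ _  = ≤-refl
    ... | inj₂ nt = begin
      0#                           ≈⟨ average-const gp nt 0# ⟨
      average val s (λ _ → 0#)     ≤⟨ average-mono-≤ gp nt (escape-nonNegative k) ⟩
      average val s (escape val k) ∎

    -- Induction through monotonicity of averages, begun by the fact that averaging the initial
    -- constant 1 returns 1. On targets the sequence drops from 1 to 0 and stays there.
    escape-decreasing : ∀ k s → escape val (ℕ.suc k) s ≤ escape val k s
    escape-decreasing k s with classify s
    ... | inj₁ _ = escape-nonNegative k s
    escape-decreasing ℕ.zero s | inj₂ nt = ≤-reflexive (average-const gp nt 1#)
    escape-decreasing (ℕ.suc k) s | inj₂ nt = begin
      average val s (escape val (ℕ.suc k)) ≤⟨ average-mono-≤ gp nt (escape-decreasing k) ⟩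
      average val s (escape val k)         ≡⟨ escape-suc val k nt ⟨
      escape val (ℕ.suc k) s               ∎

    escape-antitone : ∀ {j k} s → j ℕ.≤ k → escape val k s ≤ escape val j s
    escape-antitone {j} {k} s j≤k =
      ≡.subst (λ i → escape val i s ≤ escape val j s) (ℕ.m∸n+n≡m j≤k) (offset (k ℕ.∸ j))
      where
      offset : ∀ i → escape val (i ℕ.+ j) s ≤ escape val j s
      offset ℕ.zero    = ≤-refl
      offset (ℕ.suc i) = ≤-trans (escape-decreasing (i ℕ.+ j) s) (offset i)

    -- Induction along the path: a successor with escape probability below 1 pulls the average below
    -- 1 one step later, as the other successors never exceed 1.
    escape<1 : ∀ {s} → Absorbed s → ∃ λ k → escape val k s < 1#
    -- One step rather than none, since `escape` is 1 at time zero even on a target.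
    escape<1 (stop s∈T) = 1 , ≡.subst (_< 1#) (≡.sym (escape-target val 0 s∈T)) 0<1
    escape<1 {s} (step _ t∈Es path) with escape<1 path
    ... | k , escape<1 = ℕ.suc k , (begin-strict
      escape val (ℕ.suc k) s       ≡⟨ escape-suc val k nt ⟩
      average val s (escape val k) <⟨ average-mono-< gp nt t∈Es (λ u → escape-antitone {k = k} u ℕ.z≤n) escape<1 ⟩
      average val s (λ _ → 1#)     ≈⟨ average-const gp nt 1# ⟩
      1#                           ∎)
      where
      nt : NonTarget s
      nt = successor⇒nonTarget t∈Es

    -- By finiteness of the state set, one late enough time serves every state, by antitonicity, and
    -- a positive lower bound of the finitely many gaps is the uniform `δ`.
    uniform-escape : ∃ λ N → ∃ λ δ → 0# < δ × (∀ s → escape val N s + δ ≤ 1#)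
    uniform-escape with eventually-Π (λ s → eventually (escape<1 (absorbed s)))
      where
      eventually : ∀ {s} → (∃ λ k → escape val k s < 1#) → ∃ λ K → ∀ k → K ℕ.≤ k → escape val k s < 1#
      eventually {s} (K , escape<1) = K , λ k K≤k → ≤-<-trans (escape-antitone s K≤k) escape<1
    ... | N , escape<1 with positive-lower-bound (λ s → 1# - escape val N s)
                              (λ s → x<y⇒0<y-x (escape<1 s N ℕ.≤-refl))
    ...   | δ , 0<δ , δ≤1-escape = N , δ , 0<δ , λ s → begin
      escape val N s + δ                     ≤⟨ +-monoʳ-≤ (escape val N s) (δ≤1-escape s) ⟩
      escape val N s + (1# - escape val N s) ≈⟨ +-comm (escape val N s) (1# - escape val N s) ⟩
      1# - escape val N s + escape val N s   ≈⟨ x-y+y≈x 1# (escape val N s) ⟩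
      1#                                     ∎

    module _ {N : ℕ} {δ : Carrier} (0<δ : 0# < δ) (escape+δ≤1 : ∀ s → escape val N s + δ ≤ 1#) where

      -- Of the mass not absorbed after `k` steps, at least the fraction `δ` is absorbed within `N`
      -- more. The induction starts from the uniform gap and passes through averages by linearity,
      -- so `δ` is the same for every `k`.
      escape-contracts : ∀ k s → escape val (k ℕ.+ N) s + δ * escape val k s ≤ escape val k s
      escape-contracts ℕ.zero s = begin
        escape val N s + δ * 1# ≈⟨ +-congˡ (*-identityʳ δ) ⟩
        escape val N s + δ      ≤⟨ escape+δ≤1 s ⟩
        1#                      ∎
      escape-contracts (ℕ.suc k) s with classify s
      ... | inj₁ _  = ≤-reflexive (trans (+-identityˡ (δ * 0#)) (zeroʳ δ))
      ... | inj₂ nt = begin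
        average val s (escape val (k ℕ.+ N)) + δ * average val s (escape val k)
          ≈⟨ +-congˡ (average-* val s δ (escape val k)) ⟨
        average val s (escape val (k ℕ.+ N)) + average val s (λ t → δ * escape val k t)
          ≈⟨ average-+ val s (escape val (k ℕ.+ N)) (λ t → δ * escape val k t) ⟨
        average val s (λ t → escape val (k ℕ.+ N) t + δ * escape val k t)
          ≤⟨ average-mono-≤ gp nt (escape-contracts k) ⟩
        average val s (escape val k)
          ∎

      -- The decrements δ · escape (j N), for j < m, sum to at most 1, and
      -- escape is antitone.
      escape-telescopes : ∀ m s →
        (m · 1#) * (δ * escape val (m ℕ.* N) s) + escape val (m ℕ.* N) s ≤ 1#
      escape-telescopes ℕ.zero s = ≤-reflexive (trans (+-congʳ (zeroˡ (δ * 1#))) (+-identityˡ 1#))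
      -- The product `suc m * N` unfolds to `N + m * N`; commuting the sum gives the form `k + N`
      -- found in `escape-contracts`.
      escape-telescopes (ℕ.suc m) s rewrite ℕ.+-comm N (m ℕ.* N) = begin
        (1# + m · 1#) * (δ * b) + b           ≈⟨ +-congʳ (distribʳ (δ * b) 1# (m · 1#)) ⟩
        1# * (δ * b) + m · 1# * (δ * b) + b   ≈⟨ +-congʳ (+-congʳ (*-identityˡ (δ * b))) ⟩
        δ * b + m · 1# * (δ * b) + b          ≈⟨ +-congʳ (+-comm (δ * b) (m · 1# * (δ * b))) ⟩
        m · 1# * (δ * b) + δ * b + b          ≈⟨ +-assoc _ _ _ ⟩
        m · 1# * (δ * b) + (δ * b + b)        ≈⟨ +-congˡ (+-comm (δ * b) b) ⟩
        m · 1# * (δ * b) + (b + δ * b)        ≤⟨ +-mono-≤ (*-monoʳ-≤ (·1-nonNegative m) δb≤δa) (+-monoʳ-≤ b δb≤δa) ⟩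
        m · 1# * (δ * a) + (b + δ * a)        ≤⟨ +-monoʳ-≤ (m · 1# * (δ * a)) (escape-contracts (m ℕ.* N) s) ⟩
        m · 1# * (δ * a) + a                  ≤⟨ escape-telescopes m s ⟩
        1#                                    ∎
        where
        a b : Carrier
        a = escape val (m ℕ.* N) s
        b = escape val (m ℕ.* N ℕ.+ N) s

        δb≤δa : δ * b ≤ δ * a
        δb≤δa = *-monoʳ-≤ (<⇒≤ 0<δ) (escape-antitone s (ℕ.m≤m+n (m ℕ.* N) N))

    abstract
      -- Telescoping bounds `m` times `δ` times the escape probability after `m * N` steps by 1. The
      -- Archimedean axiom supplies an `m` above the inverse `y` of `δ * ε`, which forces that
      -- probability below `ε`.
      escape-vanishes : ∀ ε → 0# < ε → ∃ λ k → ∀ s → escape val k s < ε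
      escape-vanishes ε 0<ε with uniform-escape
      ... | N , δ , 0<δ , escape+δ≤1 with positive⇒inverse (*-pos 0<δ 0<ε)
      ...   | y , δεy≈1 with archimedean y
      ...     | m , y<m = m ℕ.* N , λ s → *-cancelˡ-< (<⇒≤ 0<δ) $ *-cancelˡ-< (·1-nonNegative m) $ begin-strict
        m · 1# * (δ * escape val (m ℕ.* N) s)
          ≈⟨ +-identityʳ _ ⟨
        m · 1# * (δ * escape val (m ℕ.* N) s) + 0#
          ≤⟨ +-monoʳ-≤ _ (escape-nonNegative (m ℕ.* N) s) ⟩
        m · 1# * (δ * escape val (m ℕ.* N) s) + escape val (m ℕ.* N) s
          ≤⟨ escape-telescopes 0<δ escape+δ≤1 m s ⟩
        1#
          ≈⟨ δεy≈1 ⟨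
        δ * ε * y
          <⟨ *-monoʳ-< (*-pos 0<δ 0<ε) y<m ⟩
        δ * ε * m · 1#
          ≈⟨ *-comm (δ * ε) (m · 1#) ⟩
        m · 1# * (δ * ε)
          ∎

    -- The two horizons share their first `N` steps, so they can disagree only on runs not absorbed
    -- by then. At `N = 0` the bound says that probabilities lie between 0 and 1.
    reach≤-offset-close : ∀ N i j s →
      reach≤ val (N ℕ.+ i) s ≤ reach≤ val (N ℕ.+ j) s + escape val N s
    reach≤-offset-close ℕ.zero i j s = begin
      reach≤ val i s      ≤⟨ reach≤-≤1 gp i s ⟩
      1#                  ≈⟨ +-identityˡ 1# ⟨
      0# + 1#             ≤⟨ +-monoˡ-≤ 1# (reach≤-nonNegative gp j s) ⟩
      reach≤ val j s + 1# ∎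
    reach≤-offset-close (ℕ.suc N) i j s with classify s
    ... | inj₁ s∈T = begin
      reach≤ val (ℕ.suc N ℕ.+ i) s      ≡⟨ reach≤-target val (ℕ.suc N ℕ.+ i) (ℕ.suc N ℕ.+ j) s∈T ⟩
      reach≤ val (ℕ.suc N ℕ.+ j) s      ≈⟨ +-identityʳ _ ⟨
      reach≤ val (ℕ.suc N ℕ.+ j) s + 0# ∎
    ... | inj₂ nt = begin
      reach≤ val (ℕ.suc N ℕ.+ i) s
        ≡⟨ reach≤-suc val (N ℕ.+ i) nt ⟩
      average val s (reach≤ val (N ℕ.+ i))
        ≤⟨ average-mono-≤ gp nt (reach≤-offset-close N i j) ⟩
      average val s (λ t → reach≤ val (N ℕ.+ j) t + escape val N t)
        ≈⟨ average-+ val s (reach≤ val (N ℕ.+ j)) (escape val N) ⟩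
      average val s (reach≤ val (N ℕ.+ j)) + average val s (escape val N)
        ≡⟨ ≡.cong (_+ average val s (escape val N)) (reach≤-suc val (N ℕ.+ j) nt) ⟨
      reach≤ val (ℕ.suc N ℕ.+ j) s + average val s (escape val N)
        ∎

    reach≤-close : ∀ {N i j} s → N ℕ.≤ i → N ℕ.≤ j → reach≤ val i s ≤ reach≤ val j s + escape val N s
    reach≤-close {N} {i} {j} s N≤i N≤j =
      ≡.subst₂ (λ i j → reach≤ val i s ≤ reach≤ val j s + escape val N s)
        (ℕ.m+[n∸m]≡n N≤i) (ℕ.m+[n∸m]≡n N≤j) (reach≤-offset-close N (i ℕ.∸ N) (j ℕ.∸ N) s)

    reach≤-cauchy : ∀ s → IsCauchy (λ k → reach≤ val k s)
    reach≤-cauchy s ε 0<ε with escape-vanishes ε 0<ε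
    ... | N , escape<ε = N , λ i j N≤i N≤j → x<y+z⇒x-y<z $ begin-strict
      reach≤ val i s                    ≤⟨ reach≤-close s N≤i N≤j ⟩
      reach≤ val j s + escape val N s   <⟨ +-monoʳ-< (reach≤ val j s) (escape<ε s) ⟩
      reach≤ val j s + ε                ∎

    value : Fin n → Carrier
    value s = proj₁ (complete (λ k → reach≤ val k s) (reach≤-cauchy s))

    reach≤-⟶-value : ∀ s → P[ val , s ]≔ value s
    reach≤-⟶-value s = proj₂ (complete (λ k → reach≤ val k s) (reach≤-cauchy s))

    value-fin : value fin ≈ 1#
    value-fin = ⟶-unique (reach≤-⟶-value fin) (⟶-const (reflexive ∘ reach≤-fin val))

    value-fail : value fail ≈ 0#
    value-fail = ⟶-unique (reach≤-⟶-value fail) (⟶-const (reflexive ∘ reach≤-fail val))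

    ∼⇒value-≈ : ∀ {s t} → s ∼ t → value s ≈ value t
    ∼⇒value-≈ {s} {t} s∼t with s∼t val gp
    ... | p , s⟶p , t⟶p = trans (⟶-unique (reach≤-⟶-value s) s⟶p) (⟶-unique t⟶p (reach≤-⟶-value t))

    -- Passage to the limit in the one-step recursion, with one `ε` for the error at `s` and one for
    -- a common error at all states inside the average.
    value-harmonic : ∀ {s} → NonTarget s → value s ≈ average val s value
    value-harmonic {s} nt = ≤-antisym (<+ε+ε⇒≤ value<average) (<+ε+ε⇒≤ average<value)
      where
      near : ∀ ε → 0# < ε → ∃ λ N → ∀ t k → N ℕ.≤ k →
        (reach≤ val k t - value t < ε) × (value t - reach≤ val k t < ε)
      near ε 0<ε = eventually-Π (λ t → reach≤-⟶-value t ε 0<ε)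

      value<average : ∀ ε → 0# < ε → value s < average val s value + ε + ε
      value<average ε 0<ε with near ε 0<ε
      ... | N , close = begin-strict
        -- Horizon `N + 1` at `s` corresponds to horizon `N` at its successors.
        value s                               <⟨ x-y<z⇒x<y+z (proj₂ (close s (ℕ.suc N) (ℕ.n≤1+n N))) ⟩
        reach≤ val (ℕ.suc N) s + ε            ≡⟨ ≡.cong (_+ ε) (reach≤-suc val N nt) ⟩
        average val s (reach≤ val N) + ε      ≤⟨ +-monoˡ-≤ ε (average-mono-≤ gp nt λ t →
                                                   <⇒≤ (x-y<z⇒x<y+z (proj₁ (close t N ℕ.≤-refl)))) ⟩
        average val s (λ t → value t + ε) + ε ≈⟨ +-congʳ (average-+const gp nt value ε) ⟩
        average val s value + ε + ε           ∎

      average<value : ∀ ε → 0# < ε → average val s value < value s + ε + ε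
      average<value ε 0<ε with near ε 0<ε
      ... | N , close = begin-strict
        average val s value                        ≤⟨ average-mono-≤ gp nt (λ t →
                                                        <⇒≤ (x-y<z⇒x<y+z (proj₂ (close t N ℕ.≤-refl)))) ⟩
        average val s (λ t → reach≤ val N t + ε)   ≈⟨ average-+const gp nt (reach≤ val N) ε ⟩
        average val s (reach≤ val N) + ε           ≡⟨ ≡.cong (_+ ε) (reach≤-suc val N nt) ⟨
        reach≤ val (ℕ.suc N) s + ε                 <⟨ +-monoˡ-< ε (x-y<z⇒x<y+z (proj₁ (close s (ℕ.suc N) (ℕ.n≤1+n N)))) ⟩
        value s + ε + ε                            ∎


  -- Avoiding paths, exits, absorption and the maximum principle.

  mapPath : ∀ {A B : Fin n → Set} → (∀ {s} → A s → B s) → ∀ {s} → PathToTarget A s → PathToTarget B s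
  mapPath A⇒B (stop s∈T)           = stop s∈T
  mapPath A⇒B (step s∈A t∈Es path) = step (A⇒B s∈A) t∈Es (mapPath A⇒B path)

  -- Cut the path after its last visit to {z, w}.
  last-visit : ∀ {z w} → z ≢ w → ∀ {s} → Absorbed s →
    PathToTarget (λ t → t ≢ z × t ≢ w) s ⊎ PathToTarget (_≢ z) w ⊎ PathToTarget (_≢ w) z
  last-visit z≢w (stop s∈T) = inj₁ (stop s∈T)
  last-visit {z} {w} z≢w {s} (step _ t∈Es path) with last-visit z≢w path
  ... | inj₂ found = inj₂ found
  ... | inj₁ rest with s ≟ z | s ≟ w
  ...   | yes ≡.refl | _          = inj₂ (inj₂ (step z≢w t∈Es (mapPath proj₂ rest)))
  ...   | no  s≢z    | yes ≡.refl = inj₂ (inj₁ (step s≢z t∈Es (mapPath proj₁ rest)))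
  ...   | no  s≢z    | no  s≢w    = inj₁ (step (s≢z , s≢w) t∈Es rest)

  -- With `last-visit` started at `w` itself, its first alternative is useful too: a path from `w`
  -- that avoids both states in particular avoids `z`.
  avoiding-path : ∀ {z w} → z ≢ w → (∀ s → Absorbed s) → PathToTarget (_≢ z) w ⊎ PathToTarget (_≢ w) z
  avoiding-path {w = w} z≢w absorbed with last-visit z≢w (absorbed w)
  ... | inj₁ path  = inj₁ (mapPath proj₁ path)
  ... | inj₂ found = found

  -- Both targets lie outside `U`, so a path that starts in `U` must leave it; the state just before
  -- it first leaves is the exit.
  exit-exists : ∀ {U : Subset n} {s} → fin ∉ U → fail ∉ U → s ∈ U → Absorbed s → ∃ (IsExit U)
  exit-exists fin∉U fail∉U s∈U (stop (inj₁ ≡.refl)) = contradiction s∈U fin∉U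
  exit-exists fin∉U fail∉U s∈U (stop (inj₂ ≡.refl)) = contradiction s∈U fail∉U
  exit-exists {U} {s} fin∉U fail∉U s∈U (step {t} _ t∈Es path) with t ∈? U
  ... | yes t∈U = exit-exists fin∉U fail∉U t∈U path
  ... | no  t∉U = s , s∈U , λ Es⊆U → t∉U (Es⊆U t∈Es)

  -- Every successor of a trapped state is trapped, so at each step only zeros are averaged.
  unabsorbed⇒reach≤-≈0 : ∀ {val} → GraphPreserving val → ∀ {s} → ¬ Absorbed s → ∀ k → reach≤ val k s ≈ 0#
  unabsorbed⇒reach≤-≈0 {val} gp {s} trapped k with classify s
  ... | inj₁ s∈T = contradiction (stop s∈T) trapped
  unabsorbed⇒reach≤-≈0 {val} gp {s} trapped ℕ.zero | inj₂ nt = reflexive (reach≤-zero val nt)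
  unabsorbed⇒reach≤-≈0 {val} gp {s} trapped (ℕ.suc k) | inj₂ nt = begin-equality
    reach≤ val (ℕ.suc k) s       ≡⟨ reach≤-suc val k nt ⟩
    average val s (reach≤ val k) ≈⟨ average-cong-successors gp nt (λ t∈Es →
                                      unabsorbed⇒reach≤-≈0 gp (trapped ∘ step tt t∈Es) k) ⟩
    average val s (λ _ → 0#)     ≈⟨ average-const gp nt 0# ⟩
    0#                           ∎

  -- A state without a path to a target has value 0 under every graph-preserving valuation, so it is
  -- equivalent to `fail`. The class of `fail` is a singleton, so the state is `fail` itself, which
  -- is a target.
  all-absorbed : StandingAssumptions → ¬ ¬ (∀ s → Absorbed s)
  all-absorbed assumptions = ¬¬-Π λ s trapped →
    trapped (stop (inj₂ (x∈⁅y⁆⇒x≡y fail (Equivalence.from (fail-class s) (fail∼ trapped)))))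
    where
    open StandingAssumptions assumptions
    fail∼ : ∀ {s} → ¬ Absorbed s → fail ∼ s
    fail∼ trapped val gp =
      0# , ⟶-const (reflexive ∘ reach≤-fail val) , ⟶-const (unabsorbed⇒reach≤-≈0 gp trapped)

  -- The maximum of D propagates along paths, through z by way of u, to a target.
  maximum-principle : ∀ {val} → GraphPreserving val → ∀ {D z u} → D u ≈ D z →
    (∀ {s} → Target s → D s ≈ 0#) → (∀ {s} → NonTarget s → s ≢ z → D s ≈ average val s D) →
    PathToTarget (_≢ z) u → (∀ s → Absorbed s) → ∀ s → D s ≤ 0#
  maximum-principle {val} gp {D} {z} {u} Du≈Dz target harmonic avoiding absorbed s 0<Ds =
    -- Once `0# < D s` is assumed the goal is absurdity, so a maximum known only under double
    -- negation is available.
    ¬¬-maximum D s λ (m , D≤Dm) → along (λ t → D≤Dm t) ≤-refl (absorbed m) (<-≤-trans 0<Ds (D≤Dm s))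
    where
    module _ {m : Fin n} (D≤Dm : ∀ t → D t ≤ D m) where

      -- A successor strictly below the maximum would pull the average at `s`, hence `D s`, below
      -- it.
      spread : ∀ {s t} → s ≢ z → t ∈ E s → D m ≤ D s → D m ≤ D t
      spread {s} {t} s≢z t∈Es Dm≤Ds Dt<Dm = Dm≤Ds $ begin-strict
        D s                       ≈⟨ harmonic nt s≢z ⟩
        average val s D           <⟨ average-mono-< gp nt t∈Es D≤Dm Dt<Dm ⟩
        average val s (λ _ → D m) ≈⟨ average-const gp nt (D m) ⟩
        D m                       ∎
        where
        nt : NonTarget s
        nt = successor⇒nonTarget t∈Es

      along-avoiding : ∀ {s} → D m ≤ D s → PathToTarget (_≢ z) s → D m ≤ 0#
      along-avoiding Dm≤Ds (stop s∈T)           = ≤-trans Dm≤Ds (≤-reflexive (target s∈T))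
      along-avoiding Dm≤Ds (step s≢z t∈Es path) = along-avoiding (spread s≢z t∈Es Dm≤Ds) path

      along : ∀ {s} → D m ≤ D s → Absorbed s → D m ≤ 0#
      along Dm≤Ds (stop s∈T) = ≤-trans Dm≤Ds (≤-reflexive (target s∈T))
      along {s} Dm≤Ds (step _ t∈Es path) with s ≟ z
      -- Harmonicity is not assumed at `z`. The maximum is carried over to `u` instead, and this
      -- jump happens only once because the path from `u` never meets `z`.
      ... | yes ≡.refl = along-avoiding (≤-trans Dm≤Ds (≤-reflexive (sym Du≈Dz))) avoiding
      ... | no  s≢z    = along (spread s≢z t∈Es Dm≤Ds) path

  -- Shifting weight between two successors.

  indicator : ∀ {m} → Fin m → Fin m → Carrier
  indicator c t = if does (t ≟ c) then 1# else 0#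

  sum-indicator : ∀ {m} (c : Fin m) (f : Fin m → Carrier) → sum (λ t → indicator c t * f t) ≈ f c
  sum-indicator zero f = begin-equality
    1# * f zero + sum (λ t → 0# * f (suc t)) ≈⟨ +-cong (*-identityˡ (f zero)) (sym (*-distribˡ-sum 0# (f ∘ suc))) ⟩
    f zero + 0# * sum (f ∘ suc)              ≈⟨ +-congˡ (zeroˡ (sum (f ∘ suc))) ⟩
    f zero + 0#                              ≈⟨ +-identityʳ (f zero) ⟩
    f zero                                   ∎
  sum-indicator (suc c) f = begin-equality
    0# * f zero + sum (λ t → indicator c t * f (suc t)) ≈⟨ +-cong (zeroˡ (f zero)) (sum-indicator c (f ∘ suc)) ⟩
    0# + f (suc c)                                      ≈⟨ +-identityˡ (f (suc c)) ⟩
    f (suc c)                                           ∎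

  -- Moving only half of the weight of z → c keeps that edge positive.
  module ShiftWeight {val : Valuation} (gp : GraphPreserving val) {z c d : Fin n}
                     (c∈Ez : c ∈ E z) (d∈Ez : d ∈ E z) (c≢d : c ≢ d) where
    open GraphPreserving gp

    nt : NonTarget z
    nt = successor⇒nonTarget c∈Ez

    η : Carrier
    η = ½ * val z c

    0<η : 0# < η
    0<η = *-pos 0<½ (positive nt c∈Ez)

    row : Fin n → Carrier
    row t = if does (t ≟ c) then η else if does (t ≟ d) then val z d + η else val z t

    shifted : Valuation
    shifted s t = if does (s ≟ z) then row t else val s t

    shifted-z : ∀ t → shifted z t ≡ row t
    shifted-z t rewrite dec-true (z ≟ z) ≡.refl = ≡.refl

    shifted-elsewhere : ∀ {s} → s ≢ z → ∀ t → shifted s t ≡ val s t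
    shifted-elsewhere {s} s≢z t rewrite dec-false (s ≟ z) s≢z = ≡.refl

    -- The new row differs from the old one by `η` times the indicator of `d` minus that of `c`;
    -- moving the negative term across avoids subtraction here and in the averages.
    row-balance : ∀ t → row t + η * indicator c t ≈ val z t + η * indicator d t
    row-balance t with t ≟ c | t ≟ d
    ... | yes ≡.refl | yes ≡.refl = contradiction ≡.refl c≢d
    ... | yes ≡.refl | no _       = begin-equality
      η + η * 1#       ≈⟨ +-congˡ (*-identityʳ η) ⟩
      η + η            ≈⟨ ½x+½x≈x (val z c) ⟩
      val z c          ≈⟨ +-identityʳ (val z c) ⟨
      val z c + 0#     ≈⟨ +-congˡ (zeroʳ η) ⟨
      val z c + η * 0# ∎
    ... | no _ | yes ≡.refl = begin-equality
      val z d + η + η * 0# ≈⟨ +-congˡ (zeroʳ η) ⟩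
      val z d + η + 0#     ≈⟨ +-identityʳ (val z d + η) ⟩
      val z d + η          ≈⟨ +-congˡ (*-identityʳ η) ⟨
      val z d + η * 1#     ∎
    ... | no _ | no _ = refl

    weighted-indicator : ∀ (w f : Fin n → Carrier) e →
      sum (λ t → (w t + η * indicator e t) * f t) ≈ sum (λ t → w t * f t) + η * f e
    weighted-indicator w f e = begin-equality
      sum (λ t → (w t + η * indicator e t) * f t)
        ≈⟨ sum-cong-≋ (λ t → trans (distribʳ (f t) (w t) (η * indicator e t))
                                   (+-congˡ (*-assoc η (indicator e t) (f t)))) ⟩
      sum (λ t → w t * f t + η * (indicator e t * f t))
        ≈⟨ ∑-distrib-+ (λ t → w t * f t) (λ t → η * (indicator e t * f t)) ⟩
      sum (λ t → w t * f t) + sum (λ t → η * (indicator e t * f t))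
        ≈⟨ +-congˡ (*-distribˡ-sum η (λ t → indicator e t * f t)) ⟨
      sum (λ t → w t * f t) + η * sum (λ t → indicator e t * f t)
        ≈⟨ +-congˡ (*-congˡ (sum-indicator e f)) ⟩
      sum (λ t → w t * f t) + η * f e
        ∎

    average-shifted-z : ∀ f → average shifted z f + η * f c ≈ average val z f + η * f d
    average-shifted-z f = begin-equality
      average shifted z f + η * f c
        ≈⟨ +-congʳ (sum-cong-≋ λ t → *-congʳ (reflexive (shifted-z t))) ⟩
      sum (λ t → row t * f t) + η * f c
        ≈⟨ weighted-indicator row f c ⟨
      sum (λ t → (row t + η * indicator c t) * f t)
        ≈⟨ sum-cong-≋ (λ t → *-congʳ (row-balance t)) ⟩
      sum (λ t → (val z t + η * indicator d t) * f t)
        ≈⟨ weighted-indicator (val z) f d ⟩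
      average val z f + η * f d
        ∎

    average-shifted-elsewhere : ∀ {s} → s ≢ z → ∀ f → average shifted s f ≈ average val s f
    average-shifted-elsewhere s≢z f = sum-cong-≋ λ t → *-congʳ (reflexive (shifted-elsewhere s≢z t))

    shifted-graphPreserving : GraphPreserving shifted
    shifted-graphPreserving = record { positive = positive′ ; null = null′ ; total = total′ }
      where
      positive′ : ∀ {s t} → NonTarget s → t ∈ E s → 0# < shifted s t
      positive′ {s} {t} s∉T t∈Es with s ≟ z
      ... | no _ = positive s∉T t∈Es
      ... | yes ≡.refl with t ≟ c | t ≟ d
      ...   | yes _ | _     = 0<η
      ...   | no _  | no _  = positive s∉T t∈Es
      ...   | no _  | yes _ = begin-strict
        0#          <⟨ positive nt d∈Ez ⟩
        val z d     ≈⟨ +-identityʳ (val z d) ⟨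
        val z d + 0# <⟨ +-monoʳ-< (val z d) 0<η ⟩
        val z d + η ∎

      null′ : ∀ {s t} → NonTarget s → t ∉ E s → shifted s t ≈ 0#
      null′ {s} {t} s∉T t∉Es with s ≟ z
      ... | no _ = null s∉T t∉Es
      ... | yes ≡.refl with t ≟ c | t ≟ d
      ...   | yes ≡.refl | _          = contradiction c∈Ez t∉Es
      ...   | no _       | yes ≡.refl = contradiction d∈Ez t∉Es
      ...   | no _       | no _       = null s∉T t∉Es

      total′ : ∀ {s} → NonTarget s → sum (shifted s) ≈ 1#
      total′ {s} s∉T with s ≟ z
      ... | no _ = total s∉T
      -- Taking the constant function 1 in `average-shifted-z` shows that the total weight is
      -- preserved.
      ... | yes ≡.refl = +-cancelʳ (η * 1#) (sum row) 1# $ begin-equality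
        sum row + η * 1#
          ≈⟨ +-congʳ (sum-cong-≋ λ t → reflexive (shifted-z t)) ⟨
        sum (shifted z) + η * 1#
          ≈⟨ +-congʳ (average-1 shifted z) ⟨
        average shifted z (λ _ → 1#) + η * 1#
          ≈⟨ average-shifted-z (λ _ → 1#) ⟩
        average val z (λ _ → 1#) + η * 1#
          ≈⟨ +-congʳ (average-const gp nt 1#) ⟩
        1# + η * 1#
          ∎

  -- Independence of the values from the distribution at one state.

  module _ (absorbed : ∀ s → Absorbed s) where
    open Convergence using (value; value-fin; value-fail; value-harmonic; ∼⇒value-≈; reach≤-⟶-value)

    value-target : ∀ {val val′} (gp : GraphPreserving val) (gp′ : GraphPreserving val′) {s} → Target s →
      value gp absorbed s ≈ value gp′ absorbed s
    value-target gp gp′ (inj₁ ≡.refl) = trans (value-fin gp absorbed) (sym (value-fin gp′ absorbed))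
    value-target gp gp′ (inj₂ ≡.refl) = trans (value-fail gp absorbed) (sym (value-fail gp′ absorbed))

    -- The maximum principle applies to the difference `D` of the two value functions. The
    -- hypotheses are symmetric in the two valuations up to the direction of `agree`, so exchanging
    -- them gives the reverse inequality.
    value-≤ : ∀ {val val′} (gp : GraphPreserving val) (gp′ : GraphPreserving val′) {z u} →
      (∀ {s} → s ≢ z → ∀ f → average val′ s f ≈ average val s f) →
      value gp absorbed u ≈ value gp absorbed z → value gp′ absorbed u ≈ value gp′ absorbed z →
      PathToTarget (_≢ z) u → ∀ s → value gp absorbed s ≤ value gp′ absorbed s
    value-≤ {val} {val′} gp gp′ {z} {u} agree xu≈xz x′u≈x′z avoiding s x′s<xs =
      maximum-principle gp {D} (+-cong xu≈xz (-‿cong x′u≈x′z)) D-target D-harmonic avoiding absorbed s (x<y⇒0<y-x x′s<xs)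
      where
      x x′ D : Fin n → Carrier
      x    = value gp absorbed
      x′   = value gp′ absorbed
      D t  = x t - x′ t

      D-target : ∀ {s} → Target s → D s ≈ 0#
      D-target {s} s∈T = trans (+-congʳ (value-target gp gp′ s∈T)) (-‿inverseʳ (x′ s))

      D-harmonic : ∀ {s} → NonTarget s → s ≢ z → D s ≈ average val s D
      D-harmonic {s} s∉T s≢z = begin-equality
        x s - x′ s                                 ≈⟨ +-cong (value-harmonic gp absorbed s∉T)
                                                             (-‿cong (value-harmonic gp′ absorbed s∉T)) ⟩
        average val s x - average val′ s x′        ≈⟨ +-congˡ (-‿cong (agree s≢z x′)) ⟩
        average val s x - average val s x′         ≈⟨ +-congˡ (average-neg val s x′) ⟨
        average val s x + average val s (-_ ∘ x′)  ≈⟨ average-+ val s x (-_ ∘ x′) ⟨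
        average val s D                            ∎

    module _ {u z : Fin n} (u∼-z : ∀ {val} (gp : GraphPreserving val) → value gp absorbed u ≈ value gp absorbed z)
             (avoiding : PathToTarget (_≢ z) u) where

      -- Shifting weight from `c` to `d` leaves all values unchanged. The harmonic equations at `z`
      -- before and after the shift then differ only by `η` times the difference of the values at
      -- `d` and `c`, so this difference vanishes.
      successors-agree : ∀ {val} (gp : GraphPreserving val) {c d} → c ∈ E z → d ∈ E z →
        value gp absorbed c ≈ value gp absorbed d
      successors-agree {val} gp {c} {d} c∈Ez d∈Ez with c ≟ d
      ... | yes ≡.refl = refl
      ... | no  c≢d    = *-cancelˡ-≈ 0<η (+-cancelˡ (x z) (η * x c) (η * x d) $ begin-equality
        x z + η * x c                  ≈⟨ +-congʳ (x≈x′ z) ⟩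
        x′ z + η * x c                 ≈⟨ +-congʳ (value-harmonic gp′ absorbed nt) ⟩
        average shifted z x′ + η * x c ≈⟨ +-congʳ (average-cong shifted z x≈x′) ⟨
        average shifted z x + η * x c  ≈⟨ average-shifted-z x ⟩
        average val z x + η * x d      ≈⟨ +-congʳ (value-harmonic gp absorbed nt) ⟨
        x z + η * x d                  ∎)
        where
        open ShiftWeight gp c∈Ez d∈Ez c≢d

        gp′ : GraphPreserving shifted
        gp′ = shifted-graphPreserving

        x x′ : Fin n → Carrier
        x  = value gp absorbed
        x′ = value gp′ absorbed

        x≈x′ : ∀ s → x s ≈ x′ s
        x≈x′ s = ≤-antisym
          (value-≤ gp gp′ average-shifted-elsewhere (u∼-z gp) (u∼-z gp′) avoiding s)
          (value-≤ gp′ gp (λ s≢z f → sym (average-shifted-elsewhere s≢z f)) (u∼-z gp′) (u∼-z gp) avoiding s)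

      value-successor : ∀ {val} (gp : GraphPreserving val) {c} → c ∈ E z →
        value gp absorbed z ≈ value gp absorbed c
      value-successor {val} gp {c} c∈Ez = begin-equality
        value gp absorbed z                         ≈⟨ value-harmonic gp absorbed nt ⟩
        average val z (value gp absorbed)           ≈⟨ average-cong-successors gp nt (λ d∈Ez →
                                                         successors-agree gp d∈Ez c∈Ez) ⟩
        average val z (λ _ → value gp absorbed c)   ≈⟨ average-const gp nt (value gp absorbed c) ⟩
        value gp absorbed c                         ∎
        where
        nt : NonTarget z
        nt = successor⇒nonTarget c∈Ez

    -- Equivalence of `w` and `z` together with the avoiding path gives each successor of `z` the
    -- value of `z` under every graph-preserving valuation, which puts it in the class of `r`.
    avoidable⇒closed : ∀ {U r z w} → U IsClassOf r → z ∈ U → w ∈ U → PathToTarget (_≢ z) w → E z ⊆ U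
    avoidable⇒closed {U} {r} {z} {w} class z∈U w∈U avoiding {c} c∈Ez =
      Equivalence.from (class c) λ val gp →
        -- Reusing the number `p` already attached to `r` and `z` leaves only the limit at `c` to be
        -- identified with it.
        let (p , r⟶p , z⟶p) = r∼z val gp
        in p , r⟶p , ⟶-respʳ-≈
             (trans (sym (value-successor w≈z avoiding gp c∈Ez)) (⟶-unique (reach≤-⟶-value gp absorbed z) z⟶p))
             (reach≤-⟶-value gp absorbed c)
      where
      r∼z : r ∼ z
      r∼z = Equivalence.to (class z) z∈U

      w≈z : ∀ {val} (gp : GraphPreserving val) → value gp absorbed w ≈ value gp absorbed z
      w≈z gp = trans (sym (∼⇒value-≈ gp absorbed (Equivalence.to (class w) w∈U))) (∼⇒value-≈ gp absorbed r∼z)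

    -- Reflexivity has content: `∼` asks for an actual limit, whose existence comes from absorption.
    ∼-refl : ∀ s → s ∼ s
    ∼-refl s val gp = value gp absorbed s , reach≤-⟶-value gp absorbed s , reach≤-⟶-value gp absorbed s

-- Existence and uniqueness of the exit.

theorem7 : ∀ {c ℓ₁ ℓ₂ ℓ₃} (ℝ : Reals c ℓ₁ ℓ₂ ℓ₃) {n : ℕ} (M : TriviallyParametricMC n) →
    let open TriviallyParametricMC M
        open Semantics ℝ M
    in StandingAssumptions →
       ∀ (U : Subset n) → IsEquivalenceClass U → fin ∉ U → fail ∉ U →
       ∃! _≡_ (λ s → IsExit U s)
theorem7 ℝ {n} M assumptions U (r , class) fin∉U fail∉U =
  proj₁ exit , proj₂ exit , unique (proj₂ exit)
  where
  open TriviallyParametricMC M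
  open ChainProperties ℝ M

  exit? : ∀ s → Dec (IsExit U s)
  exit? s = s ∈? U ×-dec ¬? (E s ⊆? U)

  exit : ∃ (IsExit U)
  -- Being an exit is decidable and the states are finite in number, so the double negation around
  -- absorption can be discharged. Reflexivity then puts the representative `r` into `U`, where the
  -- path starts.
  exit = decidable-stable (any? exit?) λ no-exit → all-absorbed assumptions λ absorbed →
    no-exit (exit-exists fin∉U fail∉U (Equivalence.from (class r) (∼-refl absorbed r)) (absorbed r))

  unique : ∀ {z} → IsExit U z → ∀ {w} → IsExit U w → z ≡ w
  unique {z} (z∈U , Ez⊈U) {w} (w∈U , Ew⊈U) = decidable-stable (z ≟ w) λ z≢w →
    all-absorbed assumptions λ absorbed →
      -- A path from one of the two states that avoids the other shows that the avoided one has all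
      -- its successors in `U`, against its being an exit.
      [ (λ path → Ez⊈U (avoidable⇒closed absorbed class z∈U w∈U path))
      , (λ path → Ew⊈U (avoidable⇒closed absorbed class w∈U z∈U path))
      ]′ (avoiding-path z≢w absorbed)
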